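{- Let $(I,+,\preceq_I,\ast)$ be a partially ordered commutative ring. Let $x_1,x_2,x_3,x_4\in I$ with $x_i\succeq_I x_{i+1}$ for $1\leq i\leq 3$ and $x_1+x_4\succeq_I x_2+x_3$, and let $n\geq 0$ be an integer. Let $a_1,a_2,a_3,a_4\in I$ and suppose that for each $i\in\{2,4\}$ there is an upper bound $\hat a_i\in I$ of $\{a_i,-a_i\}$ such that $a_1\succeq_I\hat a_2\succeq_I a_3\succeq_I\hat a_4\succeq_I 0$. Then $$\sum_{i=1}^4 a_i\ast\prod_{\substack{1\leq j\leq 4\\ j\neq i}}(x_i-x_j)^n\succeq_I 0,$$ where the product is taken with respect to $\ast$.
   Context: A partially ordered Abelian group $(I,+,\preceq_I)$ is an Abelian group with a partial order such that $x+z\preceq_I y+z\Leftrightarrow x\preceq_I y$ for all $x,y,z\in I$. A partially ordered commutative ring $(I,+,\preceq_I,\ast)$ is a partially ordered Abelian group together with an operation $\ast:I\times I\to I$ that is associative, commutative, distributive over $+$, nonnegativity-preserving ($x\succeq_I 0$ and $y\succeq_I 0$ imply $x\ast y\succeq_I 0$), and has an identity element in $I$. Powers $x^n$ are with respect to $\ast$. An element $u$ is an upper bound of $S\subset I$ if $u\succeq_I s$ for all $s\in S$. -}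

module Defs where

open import Algebra.Bundles using (CommutativeRing; Semiring)
open import Algebra.Core using (Op₁; Op₂)
open import Algebra.Structures using (IsAbelianGroup; IsCommutativeRing)
import Algebra.Definitions as Definitions
import Algebra.Definitions.RawSemiring as RawSemiringDefinitions
open import Data.Fin.Base using (Fin)
open import Data.Nat.Base using () renaming (suc to 1+_)
open import Data.Sum.Base using (_⊎_)
open import Data.Vec.Functional using (Vector; removeAt)
open import Function.Bundles using (_⇔_)
open import Level using (Level; _⊔_; suc)
open import Relation.Binary.Bundles using (Poset)
open import Relation.Binary.Core using (Rel)
open import Relation.Binary.Structures using (IsPartialOrder)
open import Relation.Unary using (Pred; _∈_)

private
  variable
    c ℓ₁ ℓ₂ : Level

record IsPartiallyOrderedAbelianGroup
         {I : Set c} (_≈_ : Rel I ℓ₁) (_≤_ : Rel I ℓ₂)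
         (_+_ : Op₂ I) (-_ : Op₁ I) (0# : I) : Set (c ⊔ ℓ₁ ⊔ ℓ₂) where
  field
    isAbelianGroup : IsAbelianGroup _≈_ _+_ 0# -_
    isPartialOrder : IsPartialOrder _≈_ _≤_
    +-≤-invariant  : ∀ x y z → (x + z) ≤ (y + z) ⇔ x ≤ y

-- 0# ≤ 1# is not assumed: it does not follow from the axioms below.
record IsPartiallyOrderedCommutativeRing
         {I : Set c} (_≈_ : Rel I ℓ₁) (_≤_ : Rel I ℓ₂)
         (_+_ _*_ : Op₂ I) (-_ : Op₁ I) (0# 1# : I) : Set (c ⊔ ℓ₁ ⊔ ℓ₂) where
  open Definitions _≈_
  field
    isPartiallyOrderedAbelianGroup :
      IsPartiallyOrderedAbelianGroup _≈_ _≤_ _+_ -_ 0#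
    *-cong     : Congruent₂ _*_
    *-assoc    : Associative _*_
    *-comm     : Commutative _*_
    *-identity : Identity 1# _*_
    distrib    : _*_ DistributesOver _+_
    *-nonNeg   : ∀ x y → 0# ≤ x → 0# ≤ y → 0# ≤ (x * y)

  open IsPartiallyOrderedAbelianGroup isPartiallyOrderedAbelianGroup public

  isCommutativeRing : IsCommutativeRing _≈_ _+_ _*_ -_ 0# 1#
  isCommutativeRing = record
    { isRing = record
      { +-isAbelianGroup = isAbelianGroup
      ; *-cong           = *-cong
      ; *-assoc          = *-assoc
      ; *-identity       = *-identity
      ; distrib          = distrib
      }
    ; *-comm = *-comm
    }

record PartiallyOrderedCommutativeRing c ℓ₁ ℓ₂ : Set (suc (c ⊔ ℓ₁ ⊔ ℓ₂)) where
  infix  8 -_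
  infixl 7 _*_
  infixl 6 _+_
  infix  4 _≈_ _≤_
  field
    Carrier : Set c
    _≈_     : Rel Carrier ℓ₁
    _≤_     : Rel Carrier ℓ₂
    _+_     : Op₂ Carrier
    _*_     : Op₂ Carrier
    -_      : Op₁ Carrier
    0#      : Carrier
    1#      : Carrier
    isPartiallyOrderedCommutativeRing :
      IsPartiallyOrderedCommutativeRing _≈_ _≤_ _+_ _*_ -_ 0# 1#

  open IsPartiallyOrderedCommutativeRing isPartiallyOrderedCommutativeRing public
    using ( isPartiallyOrderedAbelianGroup; isPartialOrder; isCommutativeRing
          ; +-≤-invariant; *-nonNeg)

  poset : Poset c ℓ₁ ℓ₂
  poset = record { isPartialOrder = isPartialOrder }

  commutativeRing : CommutativeRing c ℓ₁
  commutativeRing = record { isCommutativeRing = isCommutativeRing }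

  open Poset poset public using (_≥_)
  open CommutativeRing commutativeRing public using (_-_; semiring)
  open RawSemiringDefinitions (Semiring.rawSemiring semiring) public using (sum; product; _^_)

  infixl 10 sum-syntax product-except-syntax

  sum-syntax : ∀ n → Vector Carrier n → Carrier
  sum-syntax _ = sum

  syntax sum-syntax n (λ i → t) = ∑[ i < n ] t

  -- The product of f j over all indices j other than i.
  product-except-syntax : ∀ {n} → Fin (1+ n) → Vector Carrier (1+ n) → Carrier
  product-except-syntax i f = product (removeAt f i)

  syntax product-except-syntax i (λ j → t) = ∏[ j ≢ i ] t

  IsUpperBound : ∀ {ℓ} → Pred Carrier ℓ → Carrier → Set (c ⊔ ℓ₂ ⊔ ℓ)
  IsUpperBound S u = ∀ s → s ∈ S → u ≥ s

  doubleton : Carrier → Carrier → Pred Carrier ℓ₁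
  doubleton a b s = s ≈ a ⊎ s ≈ b

{-# OPTIONS --safe #-}

-- Put p = x₁ - x₂ ≥ r = x₃ - x₄ ≥ 0 and q = x₂ - x₃ ≥ 0. Up to sign the four products are
-- the n-th powers of
--   A = p(p+q)(p+q+r),  B = pq(q+r),  C = (p+q)qr,  D = (p+q+r)(q+r)r,
-- where the first and third products carry the sign +. Here
--   B - C = q²(p-r)  and  A - D = (p+q+r)²(p-r),
-- so C ≤ B, D ≤ A and D - C ≤ A - B, while C ≤ D factor by factor. By induction on n ≥ 1
-- these inequalities give Dⁿ - Cⁿ ≤ Aⁿ - Bⁿ, so the sum is at least
--   â₂(Aⁿ - Bⁿ) - â₄(Dⁿ - Cⁿ) ≥ 0.
-- The case n = 0 is separate because 0 ≤ 1 may fail.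

module Submission where

open import Defs
open import Algebra.Bundles using (CommutativeRing)
import Algebra.Properties.CommutativeSemigroup as CommutativeSemigroupProperties
import Algebra.Properties.CommutativeSemiring.Exp as ExpProperties
import Algebra.Properties.Ring as RingProperties
import Algebra.Solver.Ring.NaturalCoefficients.Default as SemiringSolver
open import Data.Nat.Base using (ℕ; zero; suc)
open import Data.Product.Base using (∃₂; _×_; _,_)
open import Data.Sum.Base using (_⊎_; inj₁; inj₂; map)
open import Data.Vec.Functional using (Vector; []; _∷_)
open import Function.Bundles using (Equivalence)
open import Relation.Binary.Bundles using (Poset)
import Relation.Binary.Reasoning.PartialOrder as PartialOrderReasoning

module OrderedRingProperties
  {c ℓ₁ ℓ₂} (I : PartiallyOrderedCommutativeRing c ℓ₁ ℓ₂) where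

  open PartiallyOrderedCommutativeRing I
  open CommutativeRing commutativeRing
    using ( refl; sym; trans; +-cong; +-congˡ; +-congʳ; +-comm; +-assoc
          ; +-identityˡ; +-identityʳ; -‿cong; -‿inverseˡ; -‿inverseʳ
          ; *-cong; *-congˡ; *-congʳ; *-identityʳ; distribˡ; zeroʳ
          ; ring; commutativeSemiring; +-commutativeSemigroup)
  open Poset poset using (≤-respˡ-≈; ≤-respʳ-≈)
    renaming (trans to ≤-trans)
  open RingProperties ring
    using ( -‿distribˡ-*; -‿distribʳ-*; x[y-z]≈xy-xz; [y-z]x≈yx-zx
          ; -‿involutive; ⁻¹-anti-homo‿-; //-rightDividesˡ)
  open CommutativeSemigroupProperties +-commutativeSemigroup using (interchange)
  open ExpProperties commutativeSemiring using (^-congˡ; ^-distrib-*)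
  open SemiringSolver commutativeSemiring using (solve; _:=_; _:+_; _:*_; con)
  open PartialOrderReasoning poset

  private
    variable
      a b u v w x y z : Carrier

  +-monoˡ-≤ : ∀ z → x ≤ y → x + z ≤ y + z
  +-monoˡ-≤ z = Equivalence.from (+-≤-invariant _ _ z)

  +-monoʳ-≤ : ∀ z → x ≤ y → z + x ≤ z + y
  +-monoʳ-≤ {x} {y} z x≤y = begin
    z + x  ≈⟨ +-comm z x ⟩
    x + z  ≤⟨ +-monoˡ-≤ z x≤y ⟩
    y + z  ≈⟨ +-comm y z ⟩
    z + y  ∎

  +-mono-≤ : x ≤ y → u ≤ v → x + u ≤ y + v
  +-mono-≤ {y = y} {u = u} x≤y u≤v = ≤-trans (+-monoˡ-≤ u x≤y) (+-monoʳ-≤ y u≤v)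

  +-nonNeg : 0# ≤ x → 0# ≤ y → 0# ≤ x + y
  +-nonNeg 0≤x 0≤y = ≤-respˡ-≈ (+-identityˡ 0#) (+-mono-≤ 0≤x 0≤y)

  x≤x+y : ∀ x → 0# ≤ y → x ≤ x + y
  x≤x+y x 0≤y = ≤-respˡ-≈ (+-identityʳ x) (+-monoʳ-≤ x 0≤y)

  x≤y+x : ∀ x → 0# ≤ y → x ≤ y + x
  x≤y+x x 0≤y = ≤-respˡ-≈ (+-identityˡ x) (+-monoˡ-≤ x 0≤y)

  x≤y⇒0≤y-x : x ≤ y → 0# ≤ y - x
  x≤y⇒0≤y-x {x} x≤y = ≤-respˡ-≈ (-‿inverseʳ x) (+-monoˡ-≤ (- x) x≤y)

  0≤y-x⇒x≤y : 0# ≤ y - x → x ≤ y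
  0≤y-x⇒x≤y {y} {x} 0≤y-x =
    ≤-respˡ-≈ (+-identityˡ x) (≤-respʳ-≈ (//-rightDividesˡ x y) (+-monoˡ-≤ x 0≤y-x))

  -x≤y⇒0≤y+x : - x ≤ y → 0# ≤ y + x
  -x≤y⇒0≤y+x {x} -x≤y = ≤-respˡ-≈ (-‿inverseˡ x) (+-monoˡ-≤ x -x≤y)

  x+y≤z+w⇒x-w≤z-y : x + y ≤ z + w → x - w ≤ z - y
  x+y≤z+w⇒x-w≤z-y {x} {y} {z} {w} x+y≤z+w = begin
    x - w                    ≈⟨ pad x w y ⟩
    -- The same element `- w + - y` is added to both sides of the hypothesis; it cancels `y` on the
    -- left and `w` on the right.
    (x + y) + (- w + - y)    ≤⟨ +-monoˡ-≤ _ x+y≤z+w ⟩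
    (z + w) + (- w + - y)    ≈⟨ +-congˡ (+-comm (- w) (- y)) ⟩
    (z + w) + (- y + - w)    ≈⟨ pad z y w ⟨
    z - y                    ∎
    where
    pad : ∀ x y z → x - y ≈ (x + z) + (- y + - z)
    pad x y z = begin-equality
      x - y                  ≈⟨ +-identityʳ _ ⟨
      (x - y) + 0#           ≈⟨ +-congˡ (-‿inverseʳ z) ⟨
      (x - y) + (z - z)      ≈⟨ interchange x (- y) z (- z) ⟩
      (x + z) + (- y + - z)  ∎

  -- Order, multiplication and powers.

  *-monoˡ-≤ : 0# ≤ z → x ≤ y → x * z ≤ y * z
  *-monoˡ-≤ {z} {x} {y} 0≤z x≤y =
    0≤y-x⇒x≤y (≤-respʳ-≈ ([y-z]x≈yx-zx z y x) (*-nonNeg _ _ (x≤y⇒0≤y-x x≤y) 0≤z))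

  *-monoʳ-≤ : 0# ≤ z → x ≤ y → z * x ≤ z * y
  *-monoʳ-≤ {z} {x} {y} 0≤z x≤y =
    0≤y-x⇒x≤y (≤-respʳ-≈ (x[y-z]≈xy-xz z y x) (*-nonNeg _ _ 0≤z (x≤y⇒0≤y-x x≤y)))

  *-mono-≤ : 0# ≤ x → 0# ≤ u → x ≤ y → u ≤ v → x * u ≤ y * v
  *-mono-≤ 0≤x 0≤u x≤y u≤v =
    ≤-trans (*-monoˡ-≤ 0≤u x≤y) (*-monoʳ-≤ (≤-trans 0≤x x≤y) u≤v)

  -- The exponent is `suc n` because `x ^ zero` is `1#`, which may fail to be nonnegative.
  ^-nonNeg : ∀ n → 0# ≤ x → 0# ≤ x ^ suc n
  ^-nonNeg {x} zero    0≤x = ≤-respʳ-≈ (sym (*-identityʳ x)) 0≤x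
  ^-nonNeg     (suc n) 0≤x = *-nonNeg _ _ 0≤x (^-nonNeg n 0≤x)

  [x-y]+[y-z]≈x-z : ∀ x y z → (x - y) + (y - z) ≈ x - z
  [x-y]+[y-z]≈x-z x y z = begin-equality
    (x - y) + (y - z)  ≈⟨ +-assoc (x - y) y (- z) ⟨
    ((x - y) + y) - z  ≈⟨ +-congʳ (//-rightDividesˡ y x) ⟩
    x - z              ∎

  -- Product rule for differences, by inserting `x * v`. With powers for `u` and `v` it drives the
  -- induction in `^-difference-mono-≤`.
  xu-yv≈x[u-v]+[x-y]v : ∀ x y u v → x * u - y * v ≈ x * (u - v) + (x - y) * v
  xu-yv≈x[u-v]+[x-y]v x y u v = begin-equality
    x * u - y * v                      ≈⟨ [x-y]+[y-z]≈x-z _ (x * v) _ ⟨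
    (x * u - x * v) + (x * v - y * v)  ≈⟨ +-cong (x[y-z]≈xy-xz x u v) ([y-z]x≈yx-zx v x y) ⟨
    x * (u - v) + (x - y) * v          ∎

  ^-mono-≤ : ∀ n → 0# ≤ x → x ≤ y → x ^ suc n ≤ y ^ suc n
  ^-mono-≤ {x} {y} zero    0≤x x≤y =
    ≤-respˡ-≈ (sym (*-identityʳ x)) (≤-respʳ-≈ (sym (*-identityʳ y)) x≤y)
  ^-mono-≤         (suc n) 0≤x x≤y = *-mono-≤ 0≤x (^-nonNeg n 0≤x) x≤y (^-mono-≤ n 0≤x x≤y)

  -- By induction. The product rule splits both differences into two products, compared factor by
  -- factor: `v ≤ x` and `u ≤ y` handle the plain factors, `v - u ≤ x - y` and the induction
  -- hypothesis the differences. All factors on the smaller side are nonnegative because `0# ≤ u`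
  -- and `u ≤ v`.
  ^-difference-mono-≤ : ∀ n → 0# ≤ u → u ≤ v → u ≤ y → v ≤ x → v - u ≤ x - y →
                        v ^ suc n - u ^ suc n ≤ x ^ suc n - y ^ suc n
  ^-difference-mono-≤ {u} {v} {y} {x} zero 0≤u u≤v u≤y v≤x v-u≤x-y = begin
    v * 1# - u * 1#  ≈⟨ +-cong (*-identityʳ v) (-‿cong (*-identityʳ u)) ⟩
    v - u            ≤⟨ v-u≤x-y ⟩
    x - y            ≈⟨ +-cong (*-identityʳ x) (-‿cong (*-identityʳ y)) ⟨
    x * 1# - y * 1#  ∎
  ^-difference-mono-≤ {u} {v} {y} {x} (suc n) 0≤u u≤v u≤y v≤x v-u≤x-y = begin
    v * vⁿ - u * uⁿ              ≈⟨ xu-yv≈x[u-v]+[x-y]v v u vⁿ uⁿ ⟩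
    v * (vⁿ - uⁿ) + (v - u) * uⁿ ≤⟨ +-mono-≤
      (*-mono-≤ (≤-trans 0≤u u≤v) (x≤y⇒0≤y-x (^-mono-≤ n 0≤u u≤v)) v≤x
        (^-difference-mono-≤ n 0≤u u≤v u≤y v≤x v-u≤x-y))
      (*-mono-≤ (x≤y⇒0≤y-x u≤v) (^-nonNeg n 0≤u) v-u≤x-y (^-mono-≤ n 0≤u u≤y)) ⟩
    x * (xⁿ - yⁿ) + (x - y) * yⁿ ≈⟨ xu-yv≈x[u-v]+[x-y]v x y xⁿ yⁿ ⟨
    x * xⁿ - y * yⁿ              ∎
    where
    uⁿ = u ^ suc n
    vⁿ = v ^ suc n
    xⁿ = x ^ suc n
    yⁿ = y ^ suc n

  -- Signs and two-sided bounds.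

  -x*-y≈x*y : ∀ x y → - x * - y ≈ x * y
  -x*-y≈x*y x y = begin-equality
    - x * - y      ≈⟨ -‿distribˡ-* x (- y) ⟨
    - (x * - y)    ≈⟨ -‿cong (-‿distribʳ-* x y) ⟨
    - - (x * y)    ≈⟨ -‿involutive _ ⟩
    x * y          ∎

  -- The parity of `n` decides the case; the disjunction suffices, since the bound in `-[bw]≤a[±w]`
  -- covers both signs.
  -^-sign : ∀ x n → (- x) ^ n ≈ x ^ n ⊎ (- x) ^ n ≈ - (x ^ n)
  -^-sign x zero    = inj₁ refl
  -^-sign x (suc n) with -^-sign x n
  ... | inj₁ even = inj₂ (trans (*-congˡ even) (sym (-‿distribˡ-* x (x ^ n))))
  ... | inj₂ odd  = inj₁ (trans (*-congˡ odd) (-x*-y≈x*y x (x ^ n)))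

  upperBound-≤ : IsUpperBound (doubleton a (- a)) b → a ≤ b
  upperBound-≤ bound = bound _ (inj₁ refl)

  upperBound--≤ : IsUpperBound (doubleton a (- a)) b → - a ≤ b
  upperBound--≤ bound = bound _ (inj₂ refl)

  -- Here `b` acts as an absolute value of `a`: both `b + a` and `b - a` are nonnegative, and
  -- `b * w + a * v` is one of them times `w`, according to the sign of `v`.
  -[bw]≤a[±w] : IsUpperBound (doubleton a (- a)) b → 0# ≤ w →
                v ≈ w ⊎ v ≈ - w → - (b * w) ≤ a * v
  -[bw]≤a[±w] {a} {b} {w} {v} bound 0≤w v≈±w = 0≤y-x⇒x≤y (begin
    0#                  ≤⟨ nonNeg v≈±w ⟩
    b * w + a * v       ≈⟨ +-comm _ _ ⟩
    a * v + b * w       ≈⟨ +-congˡ (-‿involutive _) ⟨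
    a * v - - (b * w)   ∎)
    where
    nonNeg : v ≈ w ⊎ v ≈ - w → 0# ≤ b * w + a * v
    nonNeg (inj₁ v≈w) = begin
      0#              ≤⟨ *-nonNeg _ _ (-x≤y⇒0≤y+x (upperBound--≤ bound)) 0≤w ⟩
      (b + a) * w     ≈⟨ solve 3 (λ b a w → (b :+ a) :* w := b :* w :+ a :* w) refl b a w ⟩
      b * w + a * w   ≈⟨ +-congˡ (*-congˡ v≈w) ⟨
      b * w + a * v   ∎
    nonNeg (inj₂ v≈-w) = begin
      0#              ≤⟨ *-nonNeg _ _ (x≤y⇒0≤y-x (upperBound-≤ bound)) 0≤w ⟩
      (b - a) * w     ≈⟨ [y-z]x≈yx-zx w b a ⟩
      b * w - a * w   ≈⟨ +-congˡ (-‿distribʳ-* a w) ⟩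
      b * w + a * - w ≈⟨ +-congˡ (*-congˡ v≈-w) ⟨
      b * w + a * v   ∎

  -- The left side, with its trailing `1#`, is the form to which `product` unfolds on three factors.
  ^-product₃ : ∀ x y z n → x ^ n * (y ^ n * (z ^ n * 1#)) ≈ (x * (y * z)) ^ n
  ^-product₃ x y z n = begin-equality
    x ^ n * (y ^ n * (z ^ n * 1#))  ≈⟨ *-congˡ (*-congˡ (*-identityʳ _)) ⟩
    x ^ n * (y ^ n * z ^ n)         ≈⟨ *-congˡ (^-distrib-* y z n) ⟨
    x ^ n * (y * z) ^ n             ≈⟨ ^-distrib-* x (y * z) n ⟨
    (x * (y * z)) ^ n               ∎

  ±-^-product₃ : ∀ x y z n → x * (y * z) ≈ - w →
                 let v = x ^ n * (y ^ n * (z ^ n * 1#)) in v ≈ w ^ n ⊎ v ≈ - (w ^ n)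
  ±-^-product₃ {w} x y z n xyz≈-w = map (trans v≈) (trans v≈) (-^-sign w n)
    where
    v≈ = trans (^-product₃ x y z n) (^-congˡ n xyz≈-w)

  -- The four products of differences.

  module FourPoints
    (x₁ x₂ x₃ x₄ : Carrier)
    (x₂≤x₁ : x₂ ≤ x₁) (x₃≤x₂ : x₃ ≤ x₂) (x₄≤x₃ : x₄ ≤ x₃)
    (x₂+x₃≤x₁+x₄ : x₂ + x₃ ≤ x₁ + x₄) where

    -- Every difference has the smaller index first, which makes it nonnegative. Restoring the
    -- original order flips no factor of `A`, one of `B`, two of `C` and three of `D`.
    A B C D : Carrier
    A = (x₁ - x₂) * ((x₁ - x₃) * (x₁ - x₄))
    B = (x₁ - x₂) * ((x₂ - x₃) * (x₂ - x₄))
    C = (x₁ - x₃) * ((x₂ - x₃) * (x₃ - x₄))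
    D = (x₁ - x₄) * ((x₂ - x₄) * (x₃ - x₄))

    -- With p = r + d and s = p + q + r the identities for A and B involve no subtraction.
    private
      q r d s : Carrier
      q = x₂ - x₃
      r = x₃ - x₄
      d = (x₁ - x₂) - r
      s = r + d + q + r

      0≤q : 0# ≤ q
      0≤q = x≤y⇒0≤y-x x₃≤x₂

      0≤r : 0# ≤ r
      0≤r = x≤y⇒0≤y-x x₄≤x₃

      -- The hypothesis on `x₁ + x₄` enters here: rearranged, it says that the first gap is at least
      -- the last one.
      0≤d : 0# ≤ d
      0≤d = x≤y⇒0≤y-x (x+y≤z+w⇒x-w≤z-y (≤-respˡ-≈ (+-comm x₂ x₃) x₂+x₃≤x₁+x₄))

      0≤r+d : 0# ≤ r + d
      0≤r+d = +-nonNeg 0≤r 0≤d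

      q≤s : q ≤ s
      q≤s = ≤-trans (x≤y+x q 0≤r+d) (x≤x+y (r + d + q) 0≤r)

      x₁-x₂≈r+d : x₁ - x₂ ≈ r + d
      x₁-x₂≈r+d = trans (sym (//-rightDividesˡ r (x₁ - x₂))) (+-comm d r)

      x₁-x₃≈r+d+q : x₁ - x₃ ≈ r + d + q
      x₁-x₃≈r+d+q = trans (sym ([x-y]+[y-z]≈x-z x₁ x₂ x₃)) (+-congʳ x₁-x₂≈r+d)

      x₁-x₄≈s : x₁ - x₄ ≈ s
      x₁-x₄≈s = trans (sym ([x-y]+[y-z]≈x-z x₁ x₃ x₄)) (+-congʳ x₁-x₃≈r+d+q)

      x₂-x₄≈q+r : x₂ - x₄ ≈ q + r
      x₂-x₄≈q+r = sym ([x-y]+[y-z]≈x-z x₂ x₃ x₄)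

      -- With `p = r + d` and the common factor `s` removed, this is
      -- `p² - r² + q(p - r) = (p - r)(p + q + r)`.
      A≈D+s²d : A ≈ D + s * s * d
      A≈D+s²d = begin-equality
        A
          ≈⟨ *-cong x₁-x₂≈r+d (*-cong x₁-x₃≈r+d+q x₁-x₄≈s) ⟩
        (r + d) * ((r + d + q) * s)
          ≈⟨ solve 3 (λ q r d →
               let s = r :+ d :+ q :+ r in
               (r :+ d) :* ((r :+ d :+ q) :* s) :=
               s :* ((q :+ r) :* r) :+ s :* s :* d) refl q r d ⟩
        s * ((q + r) * r) + s * s * d
          ≈⟨ +-congʳ (*-cong x₁-x₄≈s (*-congʳ x₂-x₄≈q+r)) ⟨
        D + s * s * d
          ∎

      -- With the common factor `q` removed, this is `p(q + r) - (p + q)r = q(p - r)`.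
      B≈C+q²d : B ≈ C + q * q * d
      B≈C+q²d = begin-equality
        B
          ≈⟨ *-cong x₁-x₂≈r+d (*-congˡ x₂-x₄≈q+r) ⟩
        (r + d) * (q * (q + r))
          ≈⟨ solve 3 (λ q r d →
               (r :+ d) :* (q :* (q :+ r)) :=
               (r :+ d :+ q) :* (q :* r) :+ q :* q :* d) refl q r d ⟩
        (r + d + q) * (q * r) + q * q * d
          ≈⟨ +-congʳ (*-congʳ x₁-x₃≈r+d+q) ⟨
        C + q * q * d
          ∎

      0≤q²d : 0# ≤ q * q * d
      0≤q²d = *-nonNeg _ _ (*-nonNeg _ _ 0≤q 0≤q) 0≤d

      q²d≤s²d : q * q * d ≤ s * s * d
      q²d≤s²d = *-monoˡ-≤ 0≤d (*-mono-≤ 0≤q 0≤q q≤s q≤s)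

      0≤x₁-x₃ : 0# ≤ x₁ - x₃
      0≤x₁-x₃ = ≤-respʳ-≈ (sym x₁-x₃≈r+d+q) (+-nonNeg 0≤r+d 0≤q)

      x₁-x₃≤x₁-x₄ : x₁ - x₃ ≤ x₁ - x₄
      x₁-x₃≤x₁-x₄ = ≤-respʳ-≈ ([x-y]+[y-z]≈x-z x₁ x₃ x₄) (x≤x+y (x₁ - x₃) 0≤r)

      q≤x₂-x₄ : q ≤ x₂ - x₄
      q≤x₂-x₄ = ≤-respʳ-≈ ([x-y]+[y-z]≈x-z x₂ x₃ x₄) (x≤x+y q 0≤r)

    0≤A : 0# ≤ A
    0≤A = *-nonNeg _ _ (x≤y⇒0≤y-x x₂≤x₁)
            (*-nonNeg _ _ 0≤x₁-x₃ (≤-trans 0≤x₁-x₃ x₁-x₃≤x₁-x₄))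

    0≤C : 0# ≤ C
    0≤C = *-nonNeg _ _ 0≤x₁-x₃ (*-nonNeg _ _ 0≤q 0≤r)

    C≤B : C ≤ B
    C≤B = ≤-respʳ-≈ (sym B≈C+q²d) (x≤x+y C 0≤q²d)

    C≤D : C ≤ D
    C≤D = *-mono-≤ 0≤x₁-x₃ (*-nonNeg _ _ 0≤q 0≤r) x₁-x₃≤x₁-x₄ (*-monoˡ-≤ 0≤r q≤x₂-x₄)

    D≤A : D ≤ A
    D≤A = ≤-respʳ-≈ (sym A≈D+s²d) (x≤x+y D (≤-trans 0≤q²d q²d≤s²d))

    -- Both `D + B` and `A + C` equal `D + C` plus a correction, namely `q * q * d` and `s * s * d`,
    -- and `q ≤ s`.
    D-C≤A-B : D - C ≤ A - B
    D-C≤A-B = x+y≤z+w⇒x-w≤z-y (begin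
      D + B                  ≈⟨ +-congˡ B≈C+q²d ⟩
      D + (C + q * q * d)    ≤⟨ +-monoʳ-≤ D (+-monoʳ-≤ C q²d≤s²d) ⟩
      D + (C + s * s * d)    ≈⟨ solve 3 (λ x y z →
        x :+ (y :+ z) := x :+ z :+ y) refl D C (s * s * d) ⟩
      (D + s * s * d) + C    ≈⟨ +-congʳ A≈D+s²d ⟨
      A + C                  ∎)

    private
      neg : ∀ x y → x - y ≈ - (y - x)
      neg x y = sym (⁻¹-anti-homo‿- y x)

      product₂≈-B : (x₂ - x₁) * ((x₂ - x₃) * (x₂ - x₄)) ≈ - B
      product₂≈-B = trans (*-congʳ (neg x₂ x₁)) (sym (-‿distribˡ-* _ _))

      product₃≈C : (x₃ - x₁) * ((x₃ - x₂) * (x₃ - x₄)) ≈ C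
      product₃≈C = begin-equality
        (x₃ - x₁) * ((x₃ - x₂) * r)          ≈⟨ *-cong (neg x₃ x₁) (*-congʳ (neg x₃ x₂)) ⟩
        - (x₁ - x₃) * (- (x₂ - x₃) * r)      ≈⟨ *-congˡ (-‿distribˡ-* _ _) ⟨
        - (x₁ - x₃) * - ((x₂ - x₃) * r)      ≈⟨ -x*-y≈x*y _ _ ⟩
        C                                    ∎

      product₄≈-D : (x₄ - x₁) * ((x₄ - x₂) * (x₄ - x₃)) ≈ - D
      product₄≈-D = begin-equality
        (x₄ - x₁) * ((x₄ - x₂) * (x₄ - x₃))        ≈⟨
          *-cong (neg x₄ x₁) (*-cong (neg x₄ x₂) (neg x₄ x₃)) ⟩
        - (x₁ - x₄) * (- (x₂ - x₄) * - (x₃ - x₄))  ≈⟨ *-congˡ (-x*-y≈x*y _ _) ⟩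
        - (x₁ - x₄) * ((x₂ - x₄) * (x₃ - x₄))      ≈⟨ -‿distribˡ-* _ _ ⟨
        - D                                        ∎

    -- Nonnegativity of the weighted sum.

    module _ (a₁ a₂ a₃ a₄ â₂ â₄ : Carrier)
      (bound₂ : IsUpperBound (doubleton a₂ (- a₂)) â₂)
      (bound₄ : IsUpperBound (doubleton a₄ (- a₄)) â₄)
      (â₂≤a₁ : â₂ ≤ a₁) (a₃≤â₂ : a₃ ≤ â₂) (â₄≤a₃ : â₄ ≤ a₃) (0≤â₄ : 0# ≤ â₄) where

      xs : Vector Carrier 4
      xs = x₁ ∷ x₂ ∷ x₃ ∷ x₄ ∷ []

      as : Vector Carrier 4
      as = a₁ ∷ a₂ ∷ a₃ ∷ a₄ ∷ []

      weightedSum-nonNeg : ∀ n → 0# ≤ ∑[ i < 4 ] (as i * (∏[ j ≢ i ] ((xs i - xs j) ^ n)))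
      -- All products are `1#`, so the sum splits into `a₁ + a₂` and `a₃ + a₄`, nonnegative by
      -- `- a₂ ≤ â₂ ≤ a₁` and `- a₄ ≤ â₄ ≤ a₃`.
      weightedSum-nonNeg zero = begin
        0#
          ≤⟨ +-nonNeg (-x≤y⇒0≤y+x (≤-trans (upperBound--≤ bound₂) â₂≤a₁))
                      (-x≤y⇒0≤y+x (≤-trans (upperBound--≤ bound₄) â₄≤a₃)) ⟩
        (a₁ + a₂) + (a₃ + a₄)
          ≈⟨ solve 4 (λ a₁ a₂ a₃ a₄ →
               let one = con 1 :* (con 1 :* (con 1 :* con 1)) in
               (a₁ :+ a₂) :+ (a₃ :+ a₄) :=
               a₁ :* one :+ (a₂ :* one :+ (a₃ :* one :+ (a₄ :* one :+ con 0)))) refl a₁ a₂ a₃ a₄ ⟩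
        _ ∎
      weightedSum-nonNeg (suc n) = begin
        0#
          ≈⟨ trans (*-congˡ (-‿inverseʳ (Dⁿ - Cⁿ))) (zeroʳ â₄) ⟨
        -- Zero is written with two copies of `Dⁿ - Cⁿ`: the positive one is enlarged to
        -- `â₂ * (Aⁿ - Bⁿ)`, the negative one is kept.
        â₄ * ((Dⁿ - Cⁿ) - (Dⁿ - Cⁿ))
          ≈⟨ *-congˡ (+-congˡ (⁻¹-anti-homo‿- Dⁿ Cⁿ)) ⟩
        â₄ * ((Dⁿ - Cⁿ) + (Cⁿ - Dⁿ))
          ≈⟨ distribˡ â₄ _ _ ⟩
        â₄ * (Dⁿ - Cⁿ) + â₄ * (Cⁿ - Dⁿ)
          ≤⟨ +-monoˡ-≤ _ (*-mono-≤ 0≤â₄ (x≤y⇒0≤y-x (^-mono-≤ n 0≤C C≤D)) (≤-trans â₄≤a₃ a₃≤â₂)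
               (^-difference-mono-≤ n 0≤C C≤D C≤B D≤A D-C≤A-B)) ⟩
        â₂ * (Aⁿ - Bⁿ) + â₄ * (Cⁿ - Dⁿ)
          ≈⟨ +-cong (x[y-z]≈xy-xz â₂ Aⁿ Bⁿ) (x[y-z]≈xy-xz â₄ Cⁿ Dⁿ) ⟩
        (â₂ * Aⁿ - â₂ * Bⁿ) + (â₄ * Cⁿ - â₄ * Dⁿ)
          ≤⟨ +-mono-≤ (+-mono-≤ term₁ term₂) (+-mono-≤ term₃ term₄) ⟩
        (a₁ * _ + a₂ * _) + (a₃ * _ + a₄ * _)
          -- Right nesting ending in zero is the unfolded form of `sum`.
          ≈⟨ solve 4 (λ t₁ t₂ t₃ t₄ →
               (t₁ :+ t₂) :+ (t₃ :+ t₄) := t₁ :+ (t₂ :+ (t₃ :+ (t₄ :+ con 0)))) refl _ _ _ _ ⟩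
        _ ∎
        where
        m  = suc n
        Aⁿ = A ^ m
        Bⁿ = B ^ m
        Cⁿ = C ^ m
        Dⁿ = D ^ m
        0≤Cⁿ = ^-nonNeg n 0≤C

        term₁ : â₂ * Aⁿ ≤ a₁ * ((x₁ - x₂) ^ m * ((x₁ - x₃) ^ m * ((x₁ - x₄) ^ m * 1#)))
        term₁ = ≤-respʳ-≈ (*-congˡ (sym (^-product₃ _ _ _ m)))
                  (*-monoˡ-≤ (^-nonNeg n 0≤A) â₂≤a₁)

        term₂ : - (â₂ * Bⁿ) ≤ a₂ * ((x₂ - x₁) ^ m * ((x₂ - x₃) ^ m * ((x₂ - x₄) ^ m * 1#)))
        term₂ = -[bw]≤a[±w] bound₂ (^-nonNeg n (≤-trans 0≤C C≤B)) (±-^-product₃ _ _ _ m product₂≈-B)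

        term₃ : â₄ * Cⁿ ≤ a₃ * ((x₃ - x₁) ^ m * ((x₃ - x₂) ^ m * ((x₃ - x₄) ^ m * 1#)))
        term₃ = ≤-respʳ-≈ (*-congˡ (sym (trans (^-product₃ _ _ _ m) (^-congˡ m product₃≈C))))
                  (*-monoˡ-≤ 0≤Cⁿ â₄≤a₃)

        term₄ : - (â₄ * Dⁿ) ≤ a₄ * ((x₄ - x₁) ^ m * ((x₄ - x₂) ^ m * ((x₄ - x₃) ^ m * 1#)))
        term₄ = -[bw]≤a[±w] bound₄ (^-nonNeg n (≤-trans 0≤C C≤D)) (±-^-product₃ _ _ _ m product₄≈-D)

theorem11 : ∀ {c ℓ₁ ℓ₂} (I : PartiallyOrderedCommutativeRing c ℓ₁ ℓ₂) →
    let open PartiallyOrderedCommutativeRing I in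
    (x₁ x₂ x₃ x₄ : Carrier) →
    x₁ ≥ x₂ → x₂ ≥ x₃ → x₃ ≥ x₄ →
    x₁ + x₄ ≥ x₂ + x₃ →
    (n : ℕ) →
    (a₁ a₂ a₃ a₄ : Carrier) →
    (∃₂ λ (â₂ â₄ : Carrier) →
      IsUpperBound (doubleton a₂ (- a₂)) â₂ ×
      IsUpperBound (doubleton a₄ (- a₄)) â₄ ×
      a₁ ≥ â₂ × â₂ ≥ a₃ × a₃ ≥ â₄ × â₄ ≥ 0#) →
    let x : Vector Carrier 4
        x = x₁ ∷ x₂ ∷ x₃ ∷ x₄ ∷ []
        a : Vector Carrier 4
        a = a₁ ∷ a₂ ∷ a₃ ∷ a₄ ∷ []
    in ∑[ i < 4 ] (a i * (∏[ j ≢ i ] ((x i - x j) ^ n))) ≥ 0#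
theorem11 I x₁ x₂ x₃ x₄ x₁≥x₂ x₂≥x₃ x₃≥x₄ x₁+x₄≥x₂+x₃ n a₁ a₂ a₃ a₄
  (â₂ , â₄ , bound₂ , bound₄ , a₁≥â₂ , â₂≥a₃ , a₃≥â₄ , â₄≥0) =
  OrderedRingProperties.FourPoints.weightedSum-nonNeg I x₁ x₂ x₃ x₄ x₁≥x₂ x₂≥x₃ x₃≥x₄ x₁+x₄≥x₂+x₃
    a₁ a₂ a₃ a₄ â₂ â₄ bound₂ bound₄ a₁≥â₂ â₂≥a₃ a₃≥â₄ â₄≥0 n
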